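{- Let $R_1=\{(0,0),(0,1),(0,2),(1,0),(2,0),(2,2),(2,3),(3,2),(3,3)\}$ and $R_2=R_1\cup\{(1,1)\}$. Then $(123,R_1)\sim_d(132,R_1)$ and $(123,R_2)\sim_d(132,R_2)$.
   Context: $S_n$ denotes the set of permutations of $[n]=\{1,\dots,n\}$, written $\pi=\pi_1\cdots\pi_n$. A mesh pattern of length $k$ is a pair $(\tau,R)$ with $\tau\in S_k$ and $R\subseteq\{0,1,\dots,k\}^2$ (the shaded boxes; box $(a,b)$ is the unit square $[a,a+1]\times[b,b+1]$ in the diagram of $\tau$). An occurrence of $(\tau,R)$ in $\pi\in S_n$ is a choice of indices $i_1<\dots<i_k$ such that $\pi_{i_1}\cdots\pi_{i_k}$ is order-isomorphic to $\tau$ and, with $i_0=0$, $i_{k+1}=n+1$, $v_1<\dots<v_k$ the values $\pi_{i_1},\dots,\pi_{i_k}$ sorted increasingly, $v_0=0$, $v_{k+1}=n+1$, for every $(a,b)\in R$ there is no index $m$ with $i_a<m<i_{a+1}$ and $v_b<\pi_m<v_{b+1}$. Mesh patterns $p,q$ are equidistributed, $p\sim_d q$, if for all $n,\ell\ge0$ the number of $\pi\in S_n$ with exactly $\ell$ occurrences of $p$ equals the number with exactly $\ell$ occurrences of $q$. -}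

module Defs where

open import Data.Nat using (ℕ; zero; suc; _+_; _∸_; _<ᵇ_; _≡ᵇ_)
open import Data.Bool using (Bool; true; false; _∧_; _∨_; not; if_then_else_)
open import Data.List using (List; []; _∷_; _++_; length; filter; map; concatMap; upTo; [_])
open import Data.Product using (_×_; _,_)
open import Relation.Binary.PropositionalEquality using (_≡_)
open import Relation.Nullary.Decidable using (Dec; yes; no)
open import Data.Bool.Properties using (T?)
open import Data.Bool using (T)

-- Conventions: a permutation π ∈ S_n is a list π₁ ⋯ πₙ of length n with
-- distinct entries from {1,…,n}.  Positions and values are 1-based.

anyᵇ : (ℕ → Bool) → List ℕ → Bool
anyᵇ f []       = false
anyᵇ f (x ∷ xs) = f x ∨ anyᵇ f xs

allᵇ : {A : Set} → (A → Bool) → List A → Bool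
allᵇ f []       = true
allᵇ f (x ∷ xs) = f x ∧ allᵇ f xs

_==_ : Bool → Bool → Bool
true  == b = b
false == b = not b

-- 1-based lookup (0 if out of range)
at : List ℕ → ℕ → ℕ
at []       _             = 0
at (x ∷ xs) zero          = 0
at (x ∷ xs) (suc zero)    = x
at (x ∷ xs) (suc (suc m)) = at xs (suc m)

-- 0-based lookup (0 if out of range)
at0 : List ℕ → ℕ → ℕ
at0 xs m = at xs (suc m)

oneTo : ℕ → List ℕ
oneTo n = map suc (upTo n)

zeroTo : ℕ → List ℕ
zeroTo n = upTo (suc n)

listsOver : List ℕ → ℕ → List (List ℕ)
listsOver xs zero    = [] ∷ []
listsOver xs (suc k) = concatMap (λ x → map (x ∷_) (listsOver xs k)) xs

choose : List ℕ → ℕ → List (List ℕ)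
choose xs       zero    = [] ∷ []
choose []       (suc k) = []
choose (x ∷ xs) (suc k) = map (x ∷_) (choose xs k) ++ choose xs (suc k)

elemᵇ : ℕ → List ℕ → Bool
elemᵇ x = anyᵇ (λ y → x ≡ᵇ y)

distinct : List ℕ → Bool
distinct []       = true
distinct (x ∷ xs) = not (elemᵇ x xs) ∧ distinct xs

isPerm : ℕ → List ℕ → Bool
isPerm n π = (length π ≡ᵇ n) ∧ allᵇ (λ x → elemᵇ x (oneTo n)) π ∧ distinct π

Sn : ℕ → List (List ℕ)
Sn n = filter (λ π → T? (isPerm n π)) (listsOver (oneTo n) n)

insert : ℕ → List ℕ → List ℕ
insert x []       = x ∷ []
insert x (y ∷ ys) = if x <ᵇ (suc y) then x ∷ y ∷ ys else y ∷ insert x ys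

sort : List ℕ → List ℕ
sort []       = []
sort (x ∷ xs) = insert x (sort xs)

-- A mesh pattern (τ, R): τ ∈ S_k given as a list, R a list of shaded boxes (a , b)
record MeshPattern : Set where
  constructor mesh
  field
    len   : ℕ
    τ     : List ℕ
    boxes : List (ℕ × ℕ)

open MeshPattern public

-- is the index list is = i₁ < ⋯ < i_k (a k-subset of [n]) an occurrence of p in π ∈ S_n?
isOcc : MeshPattern → ℕ → List ℕ → List ℕ → Bool
isOcc p n π is = iso ∧ allᵇ shadeOK (boxes p)
  where
    k   = len p
    val : ℕ → ℕ
    val a = at π (at is a)
    iso = allᵇ (λ a → allᵇ (λ b → (at (τ p) a <ᵇ at (τ p) b) == (val a <ᵇ val b)) (oneTo k)) (oneTo k)
    idx : List ℕ
    idx = 0 ∷ is ++ [ suc n ]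
    vs  : List ℕ
    vs  = 0 ∷ sort (map (at π) is) ++ [ suc n ]
    shadeOK : ℕ × ℕ → Bool
    shadeOK (a , b) = not (anyᵇ (λ m → (at0 idx a <ᵇ m) ∧ (m <ᵇ at0 idx (suc a))
                                     ∧ (at0 vs b <ᵇ at π m) ∧ (at π m <ᵇ at0 vs (suc b)))
                               (oneTo n))

occ : MeshPattern → ℕ → List ℕ → ℕ
occ p n π = length (filter (λ is → T? (isOcc p n π is)) (choose (oneTo n) (len p)))

count : MeshPattern → ℕ → ℕ → ℕ
count p n ℓ = length (filter (λ π → T? (occ p n π ≡ᵇ ℓ)) (Sn n))

_∼d_ : MeshPattern → MeshPattern → Set
p ∼d q = ∀ (n ℓ : ℕ) → count p n ℓ ≡ count q n ℓ

R₁ : List (ℕ × ℕ)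
R₁ = (0 , 0) ∷ (0 , 1) ∷ (0 , 2) ∷ (1 , 0) ∷ (2 , 0) ∷ (2 , 2) ∷ (2 , 3) ∷ (3 , 2) ∷ (3 , 3) ∷ []

R₂ : List (ℕ × ℕ)
R₂ = (1 , 1) ∷ R₁

p123 : List ℕ
p123 = 1 ∷ 2 ∷ 3 ∷ []

p132 : List ℕ
p132 = 1 ∷ 3 ∷ 2 ∷ []

{-# OPTIONS --safe #-}
module Submission where

-- Write an occurrence as positions a < x < z, and let y < d be the values at x and z in
-- increasing order.  The conditions imposed by the shading involve x and z only through y and d,
-- so interchanging the values at x and z turns an occurrence of one pattern into an occurrence of
-- the other.  The position x determines a and z, and the interchange creates or destroys no
-- occurrence with another middle position x′ and leaves its kind unchanged.  Hence, for each k,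
-- the interchange at middle position k is an involution of Sₙ which shows that counting 123
-- instead of 132 at that middle position does not affect the distribution.  Passing from 132 to
-- 123 one middle position at a time gives the theorem.

open import Defs
open import Data.Bool using (Bool; true; false; T; not; _∧_; if_then_else_)
open import Data.Bool.Properties using (T?; T-∧; T-∨; T-≡; T-not-≡)
open import Data.List using (List; []; _∷_; _++_; [_]; map; length; filter; upTo; applyUpTo; concatMap; cartesianProductWith)
open import Data.List.Membership.Propositional using (_∈_; find; lose)
open import Data.List.Membership.Propositional.Properties
open import Data.List.Properties using (∷-injective; ∷-injectiveʳ; length-++; length-map; length-applyUpTo)
open import Data.List.Relation.Unary.All as All using (All; []; _∷_)
import Data.List.Relation.Unary.All.Properties as All
open import Data.List.Relation.Unary.AllPairs as AllPairs using (AllPairs; []; _∷_)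
import Data.List.Relation.Unary.AllPairs.Properties as AllPairs
open import Data.List.Relation.Unary.Any using (here; there; any?)
open import Data.List.Relation.Unary.Unique.Propositional using (Unique)
import Data.List.Relation.Unary.Unique.Propositional.Properties as Unique
open import Data.Nat using (ℕ; zero; suc; _+_; _≤_; _<_; _<?_; _≟_; _<ᵇ_; _≡ᵇ_; s≤s; z<s; s<s; s<s⁻¹)
open import Data.Nat.Properties hiding (_≟_; _<?_)
open import Data.Product using (_×_; _,_; proj₁; proj₂; ∃-syntax)
open import Data.Sum using (_⊎_; inj₁; inj₂)
open import Function using (_∘_; id; Equivalence)
open import Relation.Binary.Definitions using (tri<; tri≈; tri>)
open import Relation.Binary.PropositionalEquality hiding ([_])
open import Relation.Nullary using (¬_; Dec; yes; no; does; contradiction)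
open import Relation.Nullary.Decidable using (_×-dec_; _⊎-dec_; dec-true; dec-false)

open Equivalence using (to; from)

-- Lists and booleans

-- Pigeonhole for a relation in place of a function: a partner `y` of the head is removed from `ys`,
-- and injectivity keeps the partners of the remaining elements in what is left. The relational form
-- suits toggles and hits, which are matched without a chosen map.
length-≤ : ∀ {A B : Set} (_~_ : A → B → Set) {xs ys} → Unique xs →
           (∀ {x} → x ∈ xs → ∃[ y ] y ∈ ys × x ~ y) →
           (∀ {x x′ y} → x ∈ xs → x′ ∈ xs → x ~ y → x′ ~ y → x ≡ x′) →
           length xs ≤ length ys
length-≤ _~_ [] image injective = _≤_.z≤n
length-≤ _~_ {x ∷ xs} {ys} (x∉xs ∷ unique) image injective
  with y , y∈ys , x~y ← image (here refl)
  with as , bs , refl ← ∈-∃++ y∈ys = begin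
    suc (length xs)          ≤⟨ s≤s (length-≤ _~_ unique image′ (λ p q → injective (there p) (there q))) ⟩
    suc (length (as ++ bs))  ≡⟨ cong suc (length-++ as) ⟩
    suc (length as + length bs)  ≡⟨ +-suc (length as) (length bs) ⟨
    length as + length (y ∷ bs)  ≡⟨ length-++ as ⟨
    length (as ++ y ∷ bs)    ∎
  where
  open ≤-Reasoning
  image′ : ∀ {x′} → x′ ∈ xs → ∃[ y′ ] y′ ∈ as ++ bs × x′ ~ y′
  image′ x′∈xs with y′ , y′∈ , x′~y′ ← image (there x′∈xs) with ∈-++⁻ as y′∈
  ... | inj₁ y′∈as         = y′ , ∈-++⁺ˡ y′∈as , x′~y′
  ... | inj₂ (there y′∈bs) = y′ , ∈-++⁺ʳ as y′∈bs , x′~y′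
  -- Here `x′` has the removed `y` as partner, so `x ≡ x′`, although the list has no repetitions.
  ... | inj₂ (here refl)   = contradiction
    (injective (here refl) (there x′∈xs) x~y x′~y′) (All.lookup x∉xs x′∈xs)

length-filter-cong : ∀ {A : Set} (f g : A → Bool) xs → (∀ {x} → x ∈ xs → f x ≡ g x) →
                     length (filter (T? ∘ f) xs) ≡ length (filter (T? ∘ g) xs)
length-filter-cong f g []       f≗g = refl
length-filter-cong f g (x ∷ xs) f≗g
  with ih ← length-filter-cong f g xs (f≗g ∘ there) | f x | g x | f≗g (here refl)
... | true  | _ | refl = cong suc ih
... | false | _ | refl = ih

T-not⁻ : ∀ {b} → T (not b) → ¬ T b
T-not⁻ {false} _ ()

T-not⁺ : ∀ {b} → ¬ T b → T (not b)
T-not⁺ {true}  ¬t = ¬t _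
T-not⁺ {false} _  = _

allᵇ⁻ : ∀ {A : Set} (f : A → Bool) xs → T (allᵇ f xs) → All (T ∘ f) xs
allᵇ⁻ f []       _ = []
allᵇ⁻ f (x ∷ xs) t with p , q ← T-∧ .to t = p ∷ allᵇ⁻ f xs q

allᵇ⁺ : ∀ {A : Set} (f : A → Bool) {xs} → All (T ∘ f) xs → T (allᵇ f xs)
allᵇ⁺ f []       = _
allᵇ⁺ f (p ∷ ps) = T-∧ .from (p , allᵇ⁺ f ps)

anyᵇ⁻ : ∀ f xs → T (anyᵇ f xs) → ∃[ x ] x ∈ xs × T (f x)
anyᵇ⁻ f (x ∷ xs) t with T-∨ .to t
... | inj₁ p = x , here refl , p
... | inj₂ q with y , y∈xs , r ← anyᵇ⁻ f xs q = y , there y∈xs , r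

anyᵇ⁺ : ∀ f {x xs} → x ∈ xs → T (f x) → T (anyᵇ f xs)
anyᵇ⁺ f (here refl)            t = T-∨ .from (inj₁ t)
anyᵇ⁺ f {xs = y ∷ _} (there p) t = T-∨ {f y} .from (inj₂ (anyᵇ⁺ f p t))

∈-oneTo⁺ : ∀ {m n} → 1 ≤ m → m ≤ n → m ∈ oneTo n
∈-oneTo⁺ {suc m} _ m<n = ∈-map⁺ suc (∈-upTo⁺ m<n)

∈-oneTo⁻ : ∀ {m n} → m ∈ oneTo n → 1 ≤ m × m ≤ n
∈-oneTo⁻ m∈ with i , i∈ , refl ← ∈-map⁻ suc m∈ = z<s , ∈-upTo⁻ i∈

oneTo-sorted : ∀ n → AllPairs _<_ (oneTo n)
oneTo-sorted n = AllPairs.map⁺ (AllPairs.applyUpTo⁺₁ id n (λ i<j _ → s<s i<j))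

oneTo-unique : ∀ n → Unique (oneTo n)
oneTo-unique n = AllPairs.map <⇒≢ (oneTo-sorted n)

length-oneTo : ∀ n → length (oneTo n) ≡ n
length-oneTo n = trans (length-map suc (upTo n)) (length-applyUpTo id n)

elemᵇ⁻ : ∀ {x} xs → T (elemᵇ x xs) → x ∈ xs
elemᵇ⁻ {x} xs t with y , y∈xs , e ← anyᵇ⁻ (x ≡ᵇ_) xs t
  with refl ← ≡ᵇ⇒≡ x y e = y∈xs

elemᵇ⁺ : ∀ {x xs} → x ∈ xs → T (elemᵇ x xs)
elemᵇ⁺ {x} x∈xs = anyᵇ⁺ (x ≡ᵇ_) x∈xs (≡⇒≡ᵇ x x refl)

distinct⁻ : ∀ xs → T (distinct xs) → Unique xs
distinct⁻ []       _ = []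
distinct⁻ (x ∷ xs) t with p , q ← T-∧ .to t =
  All.¬Any⇒All¬ xs (T-not⁻ p ∘ elemᵇ⁺) ∷ distinct⁻ xs q

distinct⁺ : ∀ {xs} → Unique xs → T (distinct xs)
distinct⁺ []                         = _
distinct⁺ {x ∷ xs} (x∉xs ∷ unique) =
  T-∧ .from (T-not⁺ (λ t → All.All¬⇒¬Any x∉xs (elemᵇ⁻ xs t)) , distinct⁺ unique)

All-at0⁺ : ∀ {P : ℕ → Set} xs → (∀ {i} → i < length xs → P (at0 xs i)) → All P xs
All-at0⁺ []       p = []
All-at0⁺ (x ∷ xs) p = p z<s ∷ All-at0⁺ xs (p ∘ s<s)

All-at0⁻ : ∀ {P : ℕ → Set} {xs} → All P xs → ∀ {i} → i < length xs → P (at0 xs i)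
All-at0⁻ (px ∷ pxs) {zero}  _ = px
All-at0⁻ (px ∷ pxs) {suc i} l = All-at0⁻ pxs (s<s⁻¹ l)

Unique-at0⁺ : ∀ xs → (∀ {i j} → i < length xs → j < length xs → at0 xs i ≡ at0 xs j → i ≡ j) →
              Unique xs
Unique-at0⁺ []       inj = []
Unique-at0⁺ (x ∷ xs) inj =
  All-at0⁺ xs (λ l e → contradiction (inj z<s (s<s l) e) λ ()) ∷
  Unique-at0⁺ xs (λ l l′ e → suc-injective (inj (s<s l) (s<s l′) e))

Unique-at0⁻ : ∀ {xs} → Unique xs → ∀ {i j} → i < length xs → j < length xs →
              at0 xs i ≡ at0 xs j → i ≡ j
Unique-at0⁻ (x∉xs ∷ u) {zero}  {zero}  _ _ _ = refl
Unique-at0⁻ (x∉xs ∷ u) {zero}  {suc j} _ l e = contradiction e (All-at0⁻ x∉xs (s<s⁻¹ l))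
Unique-at0⁻ (x∉xs ∷ u) {suc i} {zero}  l _ e = contradiction (sym e) (All-at0⁻ x∉xs (s<s⁻¹ l))
Unique-at0⁻ (x∉xs ∷ u) {suc i} {suc j} l l′ e = cong suc (Unique-at0⁻ u (s<s⁻¹ l) (s<s⁻¹ l′) e)

at0-ext : ∀ xs ys → length xs ≡ length ys → (∀ {i} → i < length xs → at0 xs i ≡ at0 ys i) → xs ≡ ys
at0-ext []       []       _ _ = refl
at0-ext (x ∷ xs) (y ∷ ys) l e = cong₂ _∷_ (e z<s) (at0-ext xs ys (suc-injective l) (e ∘ s<s))

at0-map : ∀ (f : ℕ → ℕ) {xs i} → i < length xs → at0 (map f xs) i ≡ f (at0 xs i)
at0-map f {x ∷ xs} {zero}  _ = refl
at0-map f {x ∷ xs} {suc i} l = at0-map f {xs} (s<s⁻¹ l)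

at0-applyUpTo : ∀ (f : ℕ → ℕ) {n i} → i < n → at0 (applyUpTo f n) i ≡ f i
at0-applyUpTo f {suc n} {zero}  _ = refl
at0-applyUpTo f {suc n} {suc i} l = at0-applyUpTo (f ∘ suc) (s<s⁻¹ l)

at-map-oneTo : ∀ (f : ℕ → ℕ) {n m} → 1 ≤ m → m ≤ n → at (map f (oneTo n)) m ≡ f m
at-map-oneTo f {n} {suc i} _ i<n = begin
  at0 (map f (oneTo n)) i  ≡⟨ at0-map f {oneTo n} (subst (i <_) (sym (length-oneTo n)) i<n) ⟩
  f (at0 (oneTo n) i)      ≡⟨ cong f (at0-map suc {upTo n} (subst (i <_) (sym (length-applyUpTo id n)) i<n)) ⟩
  f (suc (at0 (upTo n) i)) ≡⟨ cong (f ∘ suc) (at0-applyUpTo id i<n) ⟩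
  f (suc i)                ∎
  where open ≡-Reasoning

-- Enumeration of words, permutations and increasing triples

listsOver-suc : ∀ (xs : List ℕ) (ys : List (List ℕ)) → concatMap (λ x → map (x ∷_) ys) xs ≡ cartesianProductWith _∷_ xs ys
listsOver-suc []       ys = refl
listsOver-suc (x ∷ xs) ys = cong (map (x ∷_) ys ++_) (listsOver-suc xs ys)

listsOver-unique : ∀ {xs} → Unique xs → ∀ k → Unique (listsOver xs k)
listsOver-unique u zero    = [] ∷ []
listsOver-unique {xs} u (suc k) = subst Unique (sym (listsOver-suc xs (listsOver xs k)))
  (Unique.cartesianProductWith⁺ _∷_ ∷-injective u (listsOver-unique u k))

∈-listsOver⁺ : ∀ {xs ys} → All (_∈ xs) ys → ys ∈ listsOver xs (length ys)
∈-listsOver⁺ []                      = here refl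
∈-listsOver⁺ {xs} {y ∷ ys} (p ∷ ps) =
  subst ((y ∷ ys) ∈_) (sym (listsOver-suc xs (listsOver xs (length ys))))
    (∈-cartesianProductWith⁺ _∷_ p (∈-listsOver⁺ ps))

-- The list seen through `at` as an injective self-map of {1,...,n}, the form in which occurrences
-- and swaps are stated.
record IsPermutation (n : ℕ) (π : List ℕ) : Set where
  field
    size      : length π ≡ n
    range     : ∀ {m} → 1 ≤ m → m ≤ n → 1 ≤ at π m × at π m ≤ n
    injective : ∀ {i j} → 1 ≤ i → i ≤ n → 1 ≤ j → j ≤ n → at π i ≡ at π j → i ≡ j

∈-Sn⁻ : ∀ {n π} → π ∈ Sn n → IsPermutation n π
∈-Sn⁻ {n} {π} π∈ with ∈-filter⁻ (λ π → T? (isPerm n π)) {xs = listsOver (oneTo n) n} π∈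
... | _ , perm with s , rest ← T-∧ {length π ≡ᵇ n} .to perm
  with r , d ← T-∧ {allᵇ (λ x → elemᵇ x (oneTo n)) π} .to rest
  with refl ← ≡ᵇ⇒≡ (length π) n s = record
  { size      = refl
  ; range     = λ { {suc m} _ m<n → ∈-oneTo⁻ (elemᵇ⁻ (oneTo n)
                      (All-at0⁻ (allᵇ⁻ (λ x → elemᵇ x (oneTo n)) π r) m<n)) }
  ; injective = λ { {suc i} {suc j} _ i<n _ j<n e → cong suc (Unique-at0⁻ (distinct⁻ π d) i<n j<n e) }
  }

∈-Sn⁺ : ∀ {n π} → IsPermutation n π → π ∈ Sn n
∈-Sn⁺ {n} {π} P with refl ← IsPermutation.size P =
  ∈-filter⁺ (λ π → T? (isPerm n π)) (∈-listsOver⁺ inRange)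
    (T-∧ .from (≡⇒≡ᵇ n n refl , T-∧ {allᵇ (λ x → elemᵇ x (oneTo n)) π} .from
      ( allᵇ⁺ (λ x → elemᵇ x (oneTo n)) (All.map elemᵇ⁺ inRange)
      , distinct⁺ (Unique-at0⁺ π λ i<n j<n e → suc-injective (P.injective z<s i<n z<s j<n e)))))
  where
  module P = IsPermutation P
  inRange : All (_∈ oneTo n) π
  inRange = All-at0⁺ π λ i<n → let l , u = P.range z<s i<n in ∈-oneTo⁺ l u

Sn-unique : ∀ n → Unique (Sn n)
Sn-unique n = Unique.filter⁺ (λ π → T? (isPerm n π)) (listsOver-unique (oneTo-unique n) n)

permutation-ext : ∀ {n π ρ} → IsPermutation n π → IsPermutation n ρ →
                  (∀ {m} → 1 ≤ m → m ≤ n → at π m ≡ at ρ m) → π ≡ ρ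
permutation-ext {π = π} {ρ} P R e with refl ← IsPermutation.size P =
  at0-ext π ρ (sym (IsPermutation.size R)) (e z<s)

∈-choose⁻ : ∀ {xs} → AllPairs _<_ xs → ∀ k {ys} → ys ∈ choose xs k →
            length ys ≡ k × All (_∈ xs) ys × AllPairs _<_ ys
∈-choose⁻ s zero (here refl) = refl , [] , []
∈-choose⁻ {x ∷ xs} (x< ∷ s) (suc k) ys∈ with ∈-++⁻ (map (x ∷_) (choose xs k)) ys∈
... | inj₁ p with zs , zs∈ , refl ← ∈-map⁻ (x ∷_) p
    with l , m , t ← ∈-choose⁻ s k zs∈ =
    cong suc l , here refl ∷ All.map there m , All.map (All.lookup x<) m ∷ t
... | inj₂ q with l , m , t ← ∈-choose⁻ s (suc k) q = l , All.map there m , t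

∈-choose⁺ : ∀ {xs} → AllPairs _<_ xs → ∀ {ys} → All (_∈ xs) ys → AllPairs _<_ ys →
            ys ∈ choose xs (length ys)
∈-choose⁺ s {[]} _ _ = here refl
∈-choose⁺ {x ∷ xs} (x< ∷ s) (here refl ∷ m) (y< ∷ t) =
  ∈-++⁺ˡ (∈-map⁺ (x ∷_) (∈-choose⁺ s (tail-∈ y< m) t))
  where
  tail-∈ : ∀ {ys} → All (x <_) ys → All (_∈ x ∷ xs) ys → All (_∈ xs) ys
  tail-∈ []      []              = []
  tail-∈ (l ∷ _) (here refl ∷ _) = contradiction l (<-irrefl refl)
  tail-∈ (_ ∷ l) (there p ∷ m)   = p ∷ tail-∈ l m
∈-choose⁺ {x ∷ xs} (x< ∷ s) {y ∷ ys} (there y∈ ∷ m) (y< ∷ t) =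
  ∈-++⁺ʳ (map (x ∷_) (choose xs (length ys))) (∈-choose⁺ s (y∈ ∷ tail-∈ y< m) (y< ∷ t))
  where
  tail-∈ : ∀ {ys} → All (y <_) ys → All (_∈ x ∷ xs) ys → All (_∈ xs) ys
  tail-∈ []      []              = []
  -- An entry equal to `x` would exceed `y`, but `y` lies in `xs` and so exceeds `x`.
  tail-∈ (l ∷ _) (here refl ∷ _) = contradiction l (<-asym (All.lookup x< y∈))
  tail-∈ (_ ∷ l) (there p ∷ m)   = p ∷ tail-∈ l m

-- The two halves of `choose` are disjoint: lists in the first contain `x`, while lists in the
-- second draw on `xs`, whose members all exceed `x`.
choose-unique : ∀ {xs} → AllPairs _<_ xs → ∀ k → Unique (choose xs k)
choose-unique s        zero    = [] ∷ []
choose-unique []       (suc k) = []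
choose-unique {x ∷ xs} (x< ∷ s) (suc k) =
  Unique.++⁺ (Unique.map⁺ ∷-injectiveʳ (choose-unique s k)) (choose-unique s (suc k)) disjoint
  where
  disjoint : ∀ {ys} → ¬ (ys ∈ map (x ∷_) (choose xs k) × ys ∈ choose xs (suc k))
  disjoint (p , q) with _ , _ , refl ← ∈-map⁻ (x ∷_) p
    with _ , x∈xs ∷ _ , _ ← ∈-choose⁻ s (suc k) q = <-irrefl refl (All.lookup x< x∈xs)

triples : ℕ → List (List ℕ)
triples n = choose (oneTo n) 3

triples-unique : ∀ n → Unique (triples n)
triples-unique n = choose-unique (oneTo-sorted n) 3

data Triple (n : ℕ) : List ℕ → Set where
  triple : ∀ {a x z} → 1 ≤ a → a < x → x < z → z ≤ n → Triple n (a ∷ x ∷ z ∷ [])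

∈-triples⁻ : ∀ n {t} → t ∈ triples n → Triple n t
∈-triples⁻ n {t} t∈ with ∈-choose⁻ (oneTo-sorted n) 3 {t} t∈
∈-triples⁻ n {_ ∷ _ ∷ _ ∷ []} t∈ | _ , a∈ ∷ _ ∷ z∈ ∷ [] , (a<x ∷ _) ∷ (x<z ∷ _) ∷ _ =
  triple (proj₁ (∈-oneTo⁻ a∈)) a<x x<z (proj₂ (∈-oneTo⁻ z∈))

∈-triples⁺ : ∀ {n t} → Triple n t → t ∈ triples n
∈-triples⁺ {n} (triple 1≤a a<x x<z z≤n′) = ∈-choose⁺ (oneTo-sorted n)
  (∈-oneTo⁺ 1≤a (≤-trans (<⇒≤ a<x) x≤n) ∷ ∈-oneTo⁺ (≤-trans 1≤a (<⇒≤ a<x)) x≤n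
    ∷ ∈-oneTo⁺ (≤-trans 1≤a (<⇒≤ (<-trans a<x x<z))) z≤n′ ∷ [])
  ((a<x ∷ <-trans a<x x<z ∷ []) ∷ (x<z ∷ []) ∷ [] ∷ [])
  where x≤n = ≤-trans (<⇒≤ x<z) z≤n′

-- Occurrences as geometric conditions

data Kind : Set where
  asc desc : Kind

flip : Kind → Kind
flip asc  = desc
flip desc = asc

flip-involutive : ∀ k → flip (flip k) ≡ k
flip-involutive asc  = refl
flip-involutive desc = refl

-- y and d are the paper's v₂ and v₃, while p and q are the second and third
-- entries of the occurrence.
Values : Kind → (p q y d : ℕ) → Set
Values asc  p q y d = p ≡ y × q ≡ d
Values desc p q y d = p ≡ d × q ≡ y

values-flip : ∀ k {p q y d} → Values k p q y d → Values (flip k) q p y d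
values-flip asc  (p≡y , q≡d) = q≡d , p≡y
values-flip desc (p≡d , q≡y) = q≡y , p≡d

values-between : ∀ k {p q y d} → Values k p q y d → y ≤ d → (y ≤ p × p ≤ d) × (y ≤ q × q ≤ d)
values-between asc  (refl , refl) y≤d = (≤-refl , y≤d) , (y≤d , ≤-refl)
values-between desc (refl , refl) y≤d = (y≤d , ≤-refl) , (≤-refl , y≤d)

-- Apart from the field values, the conditions do not distinguish 123 from 132;
-- the box (1,1) is shaded when b is true.
record Occurrence (b : Bool) (k : Kind) (n : ℕ) (f : ℕ → ℕ) (a x z : ℕ) : Set where
  field
    y d    : ℕ
    values : Values k (f x) (f z) y d
    1≤a    : 1 ≤ a
    a<x    : a < x
    x<z    : x < z
    z≤n    : z ≤ n
    fa<y   : f a < y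
    y<d    : y < d
    left   : ∀ {m} → 1 ≤ m → m < a → d < f m
    low    : ∀ {m} → 1 ≤ m → m ≤ z → f a ≤ f m
    ne     : ∀ {m} → x < m → m ≤ n → m ≢ z → f m < y
    sw     : b ≡ true → ∀ {m} → 1 ≤ m → m < x → m ≢ a → y < f m

  1≤x : 1 ≤ x
  1≤x = ≤-trans 1≤a (<⇒≤ a<x)

  1≤z : 1 ≤ z
  1≤z = ≤-trans 1≤x (<⇒≤ x<z)

  x≤n : x ≤ n
  x≤n = ≤-trans (<⇒≤ x<z) z≤n

  a≤n : a ≤ n
  a≤n = ≤-trans (<⇒≤ a<x) x≤n

  between : (y ≤ f x × f x ≤ d) × (y ≤ f z × f z ≤ d)
  between = values-between k values (<⇒≤ y<d)

  y≤fx : y ≤ f x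
  y≤fx = proj₁ (proj₁ between)

  fx≤d : f x ≤ d
  fx≤d = proj₂ (proj₁ between)

  y≤fz : y ≤ f z
  y≤fz = proj₁ (proj₂ between)

  fz≤d : f z ≤ d
  fz≤d = proj₂ (proj₂ between)

-- Uniqueness of an occurrence with given middle position

module _ {b k k′ n f a a′ x z z′}
         (P : Occurrence b k n f a x z) (Q : Occurrence b k′ n f a′ x z′) where
  private
    module P = Occurrence P
    module Q = Occurrence Q

  -- If the third positions differed, `ne` of each occurrence would apply to the other's third
  -- position, giving both `f z′ < P.y ≤ f z` and `f z < Q.y ≤ f z′`. The kinds may differ.
  occurrence-unique-third : z ≡ z′
  occurrence-unique-third with z ≟ z′
  ... | yes z≡z′ = z≡z′
  ... | no  z≢z′ = contradiction
    (<-≤-trans (P.ne Q.x<z Q.z≤n (z≢z′ ∘ sym)) P.y≤fz)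
    (<-asym (<-≤-trans (Q.ne P.x<z P.z≤n z≢z′) Q.y≤fz))

  -- If `a < a′`, then `left` of `Q` puts `f a` above `Q.d`, whence `Q.d < f a < P.y ≤ f x ≤ Q.d`.
  occurrence-first-≤ : a′ ≤ a
  occurrence-first-≤ = ≮⇒≥ λ a<a′ → <-irrefl refl
    (<-trans (<-≤-trans P.fa<y P.y≤fx) (≤-<-trans Q.fx≤d (Q.left P.1≤a a<a′)))

occurrence-unique-first : ∀ {b k k′ n f a a′ x z z′} →
  Occurrence b k n f a x z → Occurrence b k′ n f a′ x z′ → a ≡ a′
occurrence-unique-first P Q = ≤-antisym (occurrence-first-≤ Q P) (occurrence-first-≤ P Q)

-- Effect of a swap on occurrences

record Swapped (n : ℕ) (f g : ℕ → ℕ) (x z : ℕ) : Set where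
  field
    at-x : g x ≡ f z
    at-z : g z ≡ f x
    off  : ∀ {m} → 1 ≤ m → m ≤ n → m ≢ x → m ≢ z → g m ≡ f m

  -- Turns a claim about the values of `g` into claims about those of `f`; the motive takes position
  -- and value separately because the swap separates them.
  elim : (C : ℕ → ℕ → Set) → C x (f z) → C z (f x) →
         (∀ {m} → m ≢ x → m ≢ z → C m (f m)) →
         ∀ {m} → 1 ≤ m → m ≤ n → C m (g m)
  elim C cx cz co {m} 1≤m m≤n with m ≟ x | m ≟ z
  ... | yes refl | _        = subst (C _) (sym at-x) cx
  ... | no _     | yes refl = subst (C _) (sym at-z) cz
  ... | no m≢x   | no m≢z   = subst (C _) (sym (off 1≤m m≤n m≢x m≢z)) (co m≢x m≢z)

swapped-sym : ∀ {n f g x z} → Swapped n f g x z → Swapped n g f x z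
swapped-sym S = record
  { at-x = sym S.at-z
  ; at-z = sym S.at-x
  ; off  = λ 1≤m m≤n m≢x m≢z → sym (S.off 1≤m m≤n m≢x m≢z)
  } where module S = Swapped S

-- The same `y` and `d` serve. Positions before `x` are fixed, `ne` concerns only fixed positions,
-- and `low` bounds all values up to position `z`, a range that contains both swapped positions.
-- Only the order of the last two entries changes.
occurrence-swap : ∀ {b k n f g a x z} → Swapped n f g x z →
                  Occurrence b k n f a x z → Occurrence b (flip k) n g a x z
occurrence-swap {k = k} {n} {f} {g} {a} {x} {z} S P = record
  { y = P.y ; d = P.d
  ; values = subst₂ (λ p q → Values (flip k) p q P.y P.d) (sym S.at-x) (sym S.at-z)
                    (values-flip k P.values)
  ; 1≤a = P.1≤a ; a<x = P.a<x ; x<z = P.x<z ; z≤n = P.z≤n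
  ; fa<y = subst (_< P.y) (sym ga≡fa) P.fa<y
  ; y<d = P.y<d
  ; left = λ 1≤m m<a → subst (P.d <_) (sym (fixed 1≤m (<-trans m<a P.a<x))) (P.left 1≤m m<a)
  ; low = λ 1≤m m≤z → subst (_≤ _) (sym ga≡fa)
      (S.elim (λ m v → 1 ≤ m → m ≤ z → f a ≤ v)
        (λ _ _ → P.low P.1≤z ≤-refl)
        (λ _ _ → P.low P.1≤x (<⇒≤ P.x<z))
        (λ _ _ → P.low)
        1≤m (≤-trans m≤z P.z≤n) 1≤m m≤z)
  ; ne = λ x<m m≤n m≢z → subst (_< P.y)
      (sym (S.off (≤-trans P.1≤x (<⇒≤ x<m)) m≤n (>⇒≢ x<m) m≢z)) (P.ne x<m m≤n m≢z)
  ; sw = λ b≡true 1≤m m<x m≢a → subst (P.y <_) (sym (fixed 1≤m m<x)) (P.sw b≡true 1≤m m<x m≢a)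
  }
  where
  module S = Swapped S
  module P = Occurrence P
  fixed : ∀ {m} → 1 ≤ m → m < x → g m ≡ f m
  fixed 1≤m m<x = S.off 1≤m (≤-trans (<⇒≤ m<x) P.x≤n) (<⇒≢ m<x) (<⇒≢ (<-trans m<x P.x<z))
  ga≡fa : g a ≡ f a
  ga≡fa = fixed P.1≤a P.a<x

module _ {b k k′ n f g a x z a′ x′ z′}
         (S : Swapped n f g x z)
         (P : Occurrence b k n f a x z) (Q : Occurrence b k′ n f a′ x′ z′) where
  private
    module S = Swapped S
    module P = Occurrence P
    module Q = Occurrence Q

    1≤-> : ∀ {m} → x′ < m → 1 ≤ m
    1≤-> x′<m = ≤-trans Q.1≤x (<⇒≤ x′<m)

    a<a′⇒d′<y : a < a′ → Q.d < P.y
    a<a′⇒d′<y a<a′ = <-trans (Q.left P.1≤a a<a′) P.fa<y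

    -- Otherwise `a < a′`, and `f x = f a′ < Q.y < Q.d < P.y ≤ f x`. The same chain excludes `z`, so
    -- the swap leaves the first entry of `Q` in place.
    a′≢x : a′ ≢ x
    a′≢x refl = <-irrefl refl
      (<-trans (<-trans Q.fa<y Q.y<d) (<-≤-trans (a<a′⇒d′<y P.a<x) P.y≤fx))

    a′≢z : a′ ≢ z
    a′≢z refl = <-irrefl refl
      (<-trans (<-trans Q.fa<y Q.y<d) (<-≤-trans (a<a′⇒d′<y (<-trans P.a<x P.x<z)) P.y≤fz))

    ga′≡fa′ : g a′ ≡ f a′
    ga′≡fa′ = S.off Q.1≤a Q.a≤n a′≢x a′≢z

  -- To the right of x′ only values are permuted, so the third index follows its value.
  occurrence-swap-left : x′ < x → ∃[ z″ ] Occurrence b k′ n g a′ x′ z″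
  occurrence-swap-left x′<x = cases (<-cmp z′ x)
    where
    x′<z : x′ < z
    x′<z = <-trans x′<x P.x<z

    fixed : ∀ {m} → 1 ≤ m → m < x → g m ≡ f m
    fixed 1≤m m<x = S.off 1≤m (≤-trans (<⇒≤ m<x) P.x≤n) (<⇒≢ m<x) (<⇒≢ (<-trans m<x P.x<z))

    build : ∀ z″ → g z″ ≡ f z′ → x′ < z″ → z″ ≤ n →
            (∀ {m} → 1 ≤ m → m ≤ z″ → f a′ ≤ g m) →
            (∀ {m} → x′ < m → m ≤ n → m ≢ z″ → g m < Q.y) →
            ∃[ z″ ] Occurrence b k′ n g a′ x′ z″
    build z″ gz″≡fz′ x′<z″ z″≤n low ne = z″ , record
      { y = Q.y ; d = Q.d
      ; values = subst₂ (λ p q → Values k′ p q Q.y Q.d) (sym (fixed Q.1≤x x′<x)) (sym gz″≡fz′) Q.values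
      ; 1≤a = Q.1≤a ; a<x = Q.a<x ; x<z = x′<z″ ; z≤n = z″≤n
      ; fa<y = subst (_< Q.y) (sym ga′≡fa′) Q.fa<y
      ; y<d = Q.y<d
      ; left = λ 1≤m m<a′ → subst (Q.d <_)
          (sym (fixed 1≤m (<-trans m<a′ (<-trans Q.a<x x′<x)))) (Q.left 1≤m m<a′)
      ; low = λ 1≤m m≤z″ → subst (_≤ _) (sym ga′≡fa′) (low 1≤m m≤z″)
      ; ne = ne
      ; sw = λ b≡true 1≤m m<x′ m≢a′ → subst (Q.y <_)
          (sym (fixed 1≤m (<-trans m<x′ x′<x))) (Q.sw b≡true 1≤m m<x′ m≢a′)
      }

    cases : _ → _
    -- All three positions of `Q` precede `x` and are fixed; the two swapped values stay to the
    -- right of `z′`.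
    cases (tri< z′<x _ _) = build z′ (fixed Q.1≤z z′<x) Q.x<z Q.z≤n
      (λ 1≤m m≤z′ → subst (f a′ ≤_) (sym (fixed 1≤m (≤-<-trans m≤z′ z′<x))) (Q.low 1≤m m≤z′))
      (λ x′<m m≤n → S.elim (λ m v → x′ < m → m ≤ n → m ≢ z′ → v < Q.y)
        (λ _ _ _ → Q.ne x′<z P.z≤n (>⇒≢ (<-trans z′<x P.x<z)))
        (λ _ _ _ → Q.ne x′<x P.x≤n (>⇒≢ z′<x))
        (λ _ _ → Q.ne)
        (1≤-> x′<m) m≤n x′<m m≤n)
    -- The third value moves from `x` to `z`. On the longer range up to `z`, `low` follows from
    -- `f a′ ≤ f a` and `low` of `P`.
    cases (tri≈ _ refl _) = build z S.at-z x′<z P.z≤n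
      (λ 1≤m m≤z → ≤-trans (Q.low P.1≤a (<⇒≤ P.a<x))
        (S.elim (λ m v → 1 ≤ m → m ≤ z → f a ≤ v)
          (λ _ _ → P.low P.1≤z ≤-refl)
          (λ _ _ → P.low P.1≤x (<⇒≤ P.x<z))
          (λ _ _ → P.low)
          1≤m (≤-trans m≤z P.z≤n) 1≤m m≤z))
      (λ x′<m m≤n → S.elim (λ m v → x′ < m → m ≤ n → m ≢ z → v < Q.y)
        (λ _ _ _ → Q.ne x′<z P.z≤n (>⇒≢ P.x<z))
        (λ _ _ z≢z → contradiction refl z≢z)
        (λ m≢x _ x′<m m≤n _ → Q.ne x′<m m≤n m≢x)
        (1≤-> x′<m) m≤n x′<m m≤n)
    cases (tri> _ _ x<z′) with z′ ≟ z
    -- A third position beyond `x` can only be `z`: otherwise `f z′ < P.y ≤ f x` and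
    -- `f x < Q.y ≤ f z′`.
    ... | no z′≢z = contradiction
      (<-≤-trans (P.ne x<z′ Q.z≤n z′≢z) P.y≤fx)
      (<-asym (<-≤-trans (Q.ne x′<x P.x≤n (<⇒≢ x<z′)) Q.y≤fz))
    ... | yes refl = build x S.at-x x′<x P.x≤n
      (λ 1≤m m≤x → S.elim (λ m v → 1 ≤ m → m ≤ x → f a′ ≤ v)
        (λ _ _ → Q.low P.1≤z ≤-refl)
        (λ _ z≤x → contradiction z≤x (<⇒≱ P.x<z))
        (λ _ _ 1≤m m≤x → Q.low 1≤m (≤-trans m≤x (<⇒≤ P.x<z)))
        1≤m (≤-trans m≤x P.x≤n) 1≤m m≤x)
      (λ x′<m m≤n → S.elim (λ m v → x′ < m → m ≤ n → m ≢ x → v < Q.y)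
        (λ _ _ x≢x → contradiction refl x≢x)
        (λ _ _ _ → Q.ne x′<x P.x≤n (<⇒≢ P.x<z))
        (λ _ m≢z x′<m m≤n _ → Q.ne x′<m m≤n m≢z)
        (1≤-> x′<m) m≤n x′<m m≤n)

  -- To the right of `x` every value other than `f z` is below `P.y`, so `Q.y < P.y` and both
  -- swapped values exceed `Q.y`. All positions of `Q` survive; at most its upper value changes, and
  -- it does so when `z` is one of `x′`, `z′`.
  occurrence-swap-right : x < x′ → Occurrence b k′ n g a′ x′ z′
  occurrence-swap-right x<x′ = cases (x′ ≟ z) (z′ ≟ z)
    where
    x<z′ : x < z′
    x<z′ = <-trans x<x′ Q.x<z

    build : ∀ d″ → Values k′ (g x′) (g z′) Q.y d″ → Q.y < d″ → Q.y < P.y →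
            (∀ {m} → 1 ≤ m → m < a′ → d″ < g m) →
            Occurrence b k′ n g a′ x′ z′
    build d″ values y′<d″ y′<y left = record
      { y = Q.y ; d = d″
      ; values = values
      ; 1≤a = Q.1≤a ; a<x = Q.a<x ; x<z = Q.x<z ; z≤n = Q.z≤n
      ; fa<y = subst (_< Q.y) (sym ga′≡fa′) Q.fa<y
      ; y<d = y′<d″
      ; left = left
      ; low = λ 1≤m m≤z′ → subst (_≤ _) (sym ga′≡fa′)
          (S.elim (λ m v → 1 ≤ m → m ≤ z′ → f a′ ≤ v)
            (λ _ _ → <⇒≤ (<-trans Q.fa<y y′<fz))
            (λ _ _ → <⇒≤ (<-trans Q.fa<y y′<fx))
            (λ _ _ → Q.low)
            1≤m (≤-trans m≤z′ Q.z≤n) 1≤m m≤z′)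
      ; ne = λ x′<m m≤n → S.elim (λ m v → x′ < m → m ≤ n → m ≢ z′ → v < Q.y)
          (λ x′<x → contradiction x′<x (<-asym x<x′))
          -- Position `z` cannot lie right of `x′` unless it is `z′`, since `f z` exceeds `Q.y`.
          (λ x′<z z≤n z≢z′ → contradiction (Q.ne x′<z z≤n z≢z′) (<-asym y′<fz))
          (λ _ _ → Q.ne)
          (1≤-> x′<m) m≤n x′<m m≤n
      ; sw = λ b≡true 1≤m m<x′ → S.elim (λ m v → 1 ≤ m → m < x′ → m ≢ a′ → Q.y < v)
          (λ _ _ _ → y′<fz)
          (λ _ _ _ → y′<fx)
          (λ _ _ → Q.sw b≡true)
          1≤m (≤-trans (<⇒≤ m<x′) Q.x≤n) 1≤m m<x′
      }
      where
      y′<fx : Q.y < f x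
      y′<fx = <-≤-trans y′<y P.y≤fx
      y′<fz : Q.y < f z
      y′<fz = <-≤-trans y′<y P.y≤fz

    -- Since `a < a′` would force `Q.d < P.y`, here `a′ ≤ a`. Positions before `a′` are then before
    -- `a`, where `left` of `P` bounds the values below by `P.d ≥ f x`.
    left-via-a : P.y ≤ Q.d → ∀ {m} → 1 ≤ m → m < a′ → f x < g m
    left-via-a y≤d′ 1≤m m<a′ = ≤-<-trans P.fx≤d (subst (P.d <_)
      (sym (S.off 1≤m (≤-trans (<⇒≤ m<a) P.a≤n) (<⇒≢ m<x) (<⇒≢ (<-trans m<x P.x<z))))
      (P.left 1≤m m<a))
      where
      m<a = <-≤-trans m<a′ (≮⇒≥ λ a<a′ → contradiction (a<a′⇒d′<y a<a′) (≤⇒≯ y≤d′))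
      m<x = <-trans m<a P.a<x

    d′<y : Values k′ (f x′) (f z′) Q.y Q.d → f x′ < P.y → f z′ < P.y → Q.d < P.y
    d′<y = go k′
      where
      go : ∀ k′ → Values k′ (f x′) (f z′) Q.y Q.d → f x′ < P.y → f z′ < P.y → Q.d < P.y
      go asc  (_ , fz′≡d′) _ fz′<y = subst (_< _) fz′≡d′ fz′<y
      go desc (fx′≡d′ , _) fx′<y _ = subst (_< _) fx′≡d′ fx′<y

    -- The order of the two entries determines the kind and hence which entry is the upper one; that
    -- entry and `d` may then be replaced together.
    asc-values : ∀ k′ → Values k′ (f x′) (f z′) Q.y Q.d → f x′ < f z′ →
                 ∀ {v} → Values k′ (f x′) v Q.y v
    asc-values asc  (e , _)  _ = e , refl
    asc-values desc (e , e′) l = contradiction (subst₂ _<_ e e′ l) (<-asym Q.y<d)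

    desc-values : ∀ k′ → Values k′ (f x′) (f z′) Q.y Q.d → f z′ < f x′ →
                  ∀ {v} → Values k′ v (f z′) Q.y v
    desc-values desc (_ , e)  _ = refl , e
    desc-values asc  (e , e′) l = contradiction (subst₂ _<_ e′ e l) (<-asym Q.y<d)

    cases : _ → _ → _
    -- With `x′ = z`, the third entry satisfies `f z′ < P.y ≤ f z`, so the upper value of `Q` sits
    -- at `z` and becomes `f x`.
    cases (yes refl) _ = build (f x)
      (subst₂ (λ p q → Values k′ p q Q.y (f x)) (sym S.at-z)
        (sym (S.off Q.1≤z Q.z≤n (>⇒≢ x<z′) (>⇒≢ Q.x<z)))
        (desc-values k′ Q.values (<-≤-trans fz′<y P.y≤fz)))
      (<-≤-trans y′<y P.y≤fx) y′<y
      (left-via-a (≤-trans P.y≤fz Q.fx≤d))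
      where
      fz′<y = P.ne x<z′ Q.z≤n (>⇒≢ Q.x<z)
      y′<y = ≤-<-trans Q.y≤fz fz′<y
    -- Mirror case: `f x′ < P.y ≤ f z`, so the upper value sits at `z′ = z` and again becomes `f x`.
    cases (no x′≢z) (yes refl) = build (f x)
      (subst₂ (λ p q → Values k′ p q Q.y (f x)) (sym (S.off Q.1≤x Q.x≤n (>⇒≢ x<x′) x′≢z))
        (sym S.at-z)
        (asc-values k′ Q.values (<-≤-trans fx′<y P.y≤fz)))
      (<-≤-trans y′<y P.y≤fx) y′<y
      (left-via-a (≤-trans P.y≤fz Q.fz≤d))
      where
      fx′<y = P.ne x<x′ Q.x≤n x′≢z
      y′<y = ≤-<-trans Q.y≤fx fx′<y
    -- Both last entries of `Q` are fixed and lie below `P.y`, so `Q.d < P.y`; swapped values to the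
    -- left of `a′` therefore still exceed `Q.d`.
    cases (no x′≢z) (no z′≢z) = build Q.d
      (subst₂ (λ p q → Values k′ p q Q.y Q.d) (sym (S.off Q.1≤x Q.x≤n (>⇒≢ x<x′) x′≢z))
        (sym (S.off Q.1≤z Q.z≤n (>⇒≢ x<z′) z′≢z)) Q.values)
      Q.y<d (≤-<-trans Q.y≤fx fx′<y)
      (λ 1≤m m<a′ → S.elim (λ m v → 1 ≤ m → m < a′ → Q.d < v)
        (λ _ _ → <-≤-trans d<y P.y≤fz)
        (λ _ _ → <-≤-trans d<y P.y≤fx)
        (λ _ _ → Q.left)
        1≤m (≤-trans (<⇒≤ m<a′) Q.a≤n) 1≤m m<a′)
      where
      fx′<y = P.ne x<x′ Q.x≤n x′≢z
      d<y = d′<y Q.values fx′<y (P.ne x<z′ Q.z≤n z′≢z)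

  occurrence-swap-elsewhere : x′ ≢ x → ∃[ z″ ] Occurrence b k′ n g a′ x′ z″
  occurrence-swap-elsewhere x′≢x with <-cmp x′ x
  ... | tri< x′<x _ _ = occurrence-swap-left x′<x
  ... | tri≈ _ x′≡x _ = contradiction x′≡x x′≢x
  ... | tri> _ _ x<x′ = z′ , occurrence-swap-right x<x′

-- Comparison with the boolean definition

word : Kind → List ℕ
word asc  = p123
word desc = p132

shading : Bool → List (ℕ × ℕ)
shading false = R₁
shading true  = R₂

meshOf : Bool → Kind → MeshPattern
meshOf b k = mesh 3 (word k) (shading b)

sameOrder : List ℕ → List ℕ → ℕ → ℕ → Bool
sameOrder τ v i j = (at τ i <ᵇ at τ j) == (at v i <ᵇ at v j)

orderIso : List ℕ → List ℕ → Bool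
orderIso τ v = allᵇ (λ i → allᵇ (sameOrder τ v i) (oneTo 3)) (oneTo 3)

inBox : (ℕ → ℕ) → (i i′ v v′ : ℕ) → ℕ → Bool
inBox f i i′ v v′ m = (i <ᵇ m) ∧ (m <ᵇ i′) ∧ (v <ᵇ f m) ∧ (f m <ᵇ v′)

emptyBox : ℕ → (ℕ → ℕ) → List ℕ → List ℕ → ℕ × ℕ → Bool
emptyBox n f is vs (i , j) =
  not (anyᵇ (inBox f (at0 is i) (at0 is (suc i)) (at0 vs j) (at0 vs (suc j))) (oneTo n))

-- Holds by computation for three explicit indices; it exposes the local definitions of `isOcc` as
-- `orderIso` and `emptyBox`.
isOcc-meshOf : ∀ b k n π a x z → let v = map (at π) (a ∷ x ∷ z ∷ []) in
  isOcc (meshOf b k) n π (a ∷ x ∷ z ∷ []) ≡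
  orderIso (word k) v ∧
  allᵇ (emptyBox n (at π) (0 ∷ a ∷ x ∷ z ∷ suc n ∷ []) (0 ∷ sort v ++ [ suc n ])) (shading b)
isOcc-meshOf b k n π a x z = refl

Empty : ℕ → (ℕ → ℕ) → (i i′ v v′ : ℕ) → Set
Empty n f i i′ v v′ = ∀ {m} → 1 ≤ m → m ≤ n → i < m → m < i′ → v < f m → ¬ f m < v′

inBox⁻ : ∀ f i i′ v v′ m → T (inBox f i i′ v v′ m) → i < m × m < i′ × v < f m × f m < v′
inBox⁻ f i i′ v v′ m t
  with p , t ← T-∧ {i <ᵇ m} .to t
  with q , t ← T-∧ {m <ᵇ i′} .to t
  with r , s ← T-∧ {v <ᵇ f m} .to t =
  <ᵇ⇒< i m p , <ᵇ⇒< m i′ q , <ᵇ⇒< v (f m) r , <ᵇ⇒< (f m) v′ s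

inBox⁺ : ∀ f {i i′ v v′ m} → i < m → m < i′ → v < f m → f m < v′ → T (inBox f i i′ v v′ m)
inBox⁺ f p q r s = T-∧ .from (<⇒<ᵇ p , T-∧ .from (<⇒<ᵇ q , T-∧ .from (<⇒<ᵇ r , <⇒<ᵇ s)))

empty⁻ : ∀ {n f i i′ v v′} → T (not (anyᵇ (inBox f i i′ v v′) (oneTo n))) → Empty n f i i′ v v′
empty⁻ {f = f} t 1≤m m≤n p q r s = T-not⁻ t (anyᵇ⁺ _ (∈-oneTo⁺ 1≤m m≤n) (inBox⁺ f p q r s))

empty⁺ : ∀ {n f i i′ v v′} → Empty n f i i′ v v′ → T (not (anyᵇ (inBox f i i′ v v′) (oneTo n)))
empty⁺ {n} {f} {i} {i′} {v} {v′} e = T-not⁺ notAny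
  where
  notAny : ¬ T (anyᵇ (inBox f i i′ v v′) (oneTo n))
  notAny t with m , m∈ , t ← anyᵇ⁻ _ (oneTo n) t
    with p , q , r , s ← inBox⁻ f i i′ v v′ m t = e (proj₁ (∈-oneTo⁻ m∈)) (proj₂ (∈-oneTo⁻ m∈)) p q r s

<⇒<ᵇ≡true : ∀ {m n} → m < n → (m <ᵇ n) ≡ true
<⇒<ᵇ≡true m<n = T-≡ .to (<⇒<ᵇ m<n)

≥⇒<ᵇ≡false : ∀ {m n} → n ≤ m → (m <ᵇ n) ≡ false
≥⇒<ᵇ≡false {m} {n} n≤m = T-not-≡ .to (T-not⁺ (λ t → ≤⇒≯ n≤m (<ᵇ⇒< m n t)))

-- Once the nine comparisons among `v`, `y` and `d` are evaluated, the test computes to `true`.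
orderIso⁺ : ∀ k {v p q y d} → Values k p q y d → v < y → y < d →
            T (orderIso (word k) (v ∷ p ∷ q ∷ []))
orderIso⁺ asc {v} {y = y} {d} (refl , refl) v<y y<d
  rewrite ≥⇒<ᵇ≡false (≤-refl {v}) | ≥⇒<ᵇ≡false (≤-refl {y}) | ≥⇒<ᵇ≡false (≤-refl {d})
        | <⇒<ᵇ≡true v<y | <⇒<ᵇ≡true y<d | <⇒<ᵇ≡true (<-trans v<y y<d)
        | ≥⇒<ᵇ≡false (<⇒≤ v<y) | ≥⇒<ᵇ≡false (<⇒≤ y<d) | ≥⇒<ᵇ≡false (<⇒≤ (<-trans v<y y<d)) = _
orderIso⁺ desc {v} {y = y} {d} (refl , refl) v<y y<d
  rewrite ≥⇒<ᵇ≡false (≤-refl {v}) | ≥⇒<ᵇ≡false (≤-refl {y}) | ≥⇒<ᵇ≡false (≤-refl {d})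
        | <⇒<ᵇ≡true v<y | <⇒<ᵇ≡true y<d | <⇒<ᵇ≡true (<-trans v<y y<d)
        | ≥⇒<ᵇ≡false (<⇒≤ v<y) | ≥⇒<ᵇ≡false (<⇒≤ y<d) | ≥⇒<ᵇ≡false (<⇒≤ (<-trans v<y y<d)) = _

lower upper : Kind → ℕ → ℕ → ℕ
lower asc  p q = p
lower desc p q = q
upper asc  p q = q
upper desc p q = p

values-lower-upper : ∀ k p q → Values k p q (lower k p q) (upper k p q)
values-lower-upper asc  p q = refl , refl
values-lower-upper desc p q = refl , refl

orderIso-entries : ∀ τ v → T (orderIso τ v) →
  All (λ i → All (T ∘ sameOrder τ v i) (oneTo 3)) (oneTo 3)
orderIso-entries τ v t = All.map (allᵇ⁻ _ (oneTo 3)) (allᵇ⁻ _ (oneTo 3) t)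

orderIso⁻ : ∀ k v p q → T (orderIso (word k) (v ∷ p ∷ q ∷ [])) →
            v < lower k p q × lower k p q < upper k p q
orderIso⁻ k@asc v p q t
  with (_ ∷ v<p ∷ _) ∷ (_ ∷ _ ∷ p<q ∷ []) ∷ _ ←
       orderIso-entries (word k) (v ∷ p ∷ q ∷ []) t = <ᵇ⇒< v p v<p , <ᵇ⇒< p q p<q
orderIso⁻ k@desc v p q t
  with (_ ∷ _ ∷ v<q ∷ []) ∷ _ ∷ (_ ∷ q<p ∷ _) ∷ [] ←
       orderIso-entries (word k) (v ∷ p ∷ q ∷ []) t = <ᵇ⇒< v q v<q , <ᵇ⇒< q p q<p

sort-values : ∀ k {v p q y d} → Values k p q y d → v < y → y < d →
              sort (v ∷ p ∷ q ∷ []) ≡ v ∷ y ∷ d ∷ []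
sort-values asc (refl , refl) v<y y<d
  rewrite <⇒<ᵇ≡true (m<n⇒m<1+n y<d) | <⇒<ᵇ≡true (m<n⇒m<1+n v<y) = refl
sort-values desc (refl , refl) v<y y<d
  -- `insert` tests `d <ᵇ suc y`, and `y<d` is by definition `suc y ≤ d`.
  rewrite ≥⇒<ᵇ≡false y<d | <⇒<ᵇ≡true (m<n⇒m<1+n v<y) = refl

-- Translation between shaded boxes and inequalities

module _ {n π a x z} (perm : IsPermutation n π)
         (1≤a : 1 ≤ a) (a<x : a < x) (x<z : x < z) (z≤n : z ≤ n) where
  private
    module π = IsPermutation perm
    f = at π
    1≤x = ≤-trans 1≤a (<⇒≤ a<x)
    1≤z = ≤-trans 1≤x (<⇒≤ x<z)
    x≤n = ≤-trans (<⇒≤ x<z) z≤n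
    a≤n = ≤-trans (<⇒≤ a<x) x≤n

    value-position : ∀ k {m} → 1 ≤ m → m ≤ n →
      f m ≡ lower k (f x) (f z) ⊎ f m ≡ upper k (f x) (f z) → m ≡ x ⊎ m ≡ z
    value-position asc  1≤m m≤n (inj₁ e) = inj₁ (π.injective 1≤m m≤n 1≤x x≤n e)
    value-position asc  1≤m m≤n (inj₂ e) = inj₂ (π.injective 1≤m m≤n 1≤z z≤n e)
    value-position desc 1≤m m≤n (inj₁ e) = inj₂ (π.injective 1≤m m≤n 1≤z z≤n e)
    value-position desc 1≤m m≤n (inj₂ e) = inj₁ (π.injective 1≤m m≤n 1≤x x≤n e)

    Shaded : ℕ → ℕ → ℕ × ℕ → Set
    Shaded y d = T ∘ emptyBox n f (0 ∷ a ∷ x ∷ z ∷ suc n ∷ []) (0 ∷ f a ∷ y ∷ d ∷ suc n ∷ [])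

    shaded-R₁ : ∀ b {P : ℕ × ℕ → Set} → All P (shading b) → All P R₁
    shaded-R₁ false ps       = ps
    shaded-R₁ true  (_ ∷ ps) = ps

    shaded-center : ∀ {b} {P : ℕ × ℕ → Set} → All P (shading b) → b ≡ true → P (1 , 1)
    shaded-center (p ∷ _) refl = p

    shaded : ∀ b {P : ℕ × ℕ → Set} → All P R₁ → (b ≡ true → P (1 , 1)) → All P (shading b)
    shaded false ps _ = ps
    shaded true  ps p = p refl ∷ ps

    -- Boxes (0,0), (0,1), (0,2) give `left`; (0,0), (1,0), (2,0) give `low`; (2,2), (2,3), (3,2),
    -- (3,3) give `ne`; and (1,1), with `left` and `low`, gives `sw`. Injectivity of the permutation
    -- rules out points on the lines between boxes.
    fromBoxes : ∀ b k → let y = lower k (f x) (f z); d = upper k (f x) (f z) in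
                f a < y → y < d → All (Shaded y d) (shading b) → Occurrence b k n f a x z
    fromBoxes b k fa<y y<d boxes
      with e00 ∷ e01 ∷ e02 ∷ e10 ∷ e20 ∷ e22 ∷ e23 ∷ e32 ∷ e33 ∷ [] ← shaded-R₁ b boxes = record
      { y = y ; d = d ; values = values-lower-upper k (f x) (f z)
      ; 1≤a = 1≤a ; a<x = a<x ; x<z = x<z ; z≤n = z≤n ; fa<y = fa<y ; y<d = y<d
      ; left = left
      ; low = λ 1≤m m≤z → ≮⇒≥ (low 1≤m m≤z)
      ; ne = λ x<m m≤n m≢z → ≰⇒> (ne x<m m≤n m≢z)
      ; sw = sw
      }
      where
      y = lower k (f x) (f z)
      d = upper k (f x) (f z)

      y≤fx : y ≤ f x
      y≤fx = proj₁ (proj₁ (values-between k (values-lower-upper k (f x) (f z)) (<⇒≤ y<d)))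

      y≤fz : y ≤ f z
      y≤fz = proj₁ (proj₂ (values-between k (values-lower-upper k (f x) (f z)) (<⇒≤ y<d)))

      not-value : ∀ {m} → 1 ≤ m → m ≤ n → m ≢ x → m ≢ z → f m ≢ y × f m ≢ d
      not-value {m} 1≤m m≤n m≢x m≢z = (λ e → absurd (inj₁ e)) , (λ e → absurd (inj₂ e))
        where
        absurd : ¬ (f m ≡ y ⊎ f m ≡ d)
        absurd e with value-position k 1≤m m≤n e
        ... | inj₁ m≡x = m≢x m≡x
        ... | inj₂ m≡z = m≢z m≡z

      left : ∀ {m} → 1 ≤ m → m < a → d < f m
      left {m} 1≤m m<a = go (<-cmp (f m) (f a)) (<-cmp (f m) y) (<-cmp (f m) d)
        where
        m≤n = ≤-trans (<⇒≤ m<a) a≤n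
        nv = not-value 1≤m m≤n (<⇒≢ (<-trans m<a a<x)) (<⇒≢ (<-trans m<a (<-trans a<x x<z)))
        go : _ → _ → _ → d < f m
        -- The outer box boundaries are 0, so `1≤m` and the range bound on `f m` serve as strict
        -- inequalities.
        go (tri< l _ _) _ _ = contradiction l (empty⁻ {f = f} e00 1≤m m≤n 1≤m m<a (proj₁ (π.range 1≤m m≤n)))
        go (tri≈ _ e _) _ _ = contradiction (π.injective 1≤m m≤n 1≤a a≤n e) (<⇒≢ m<a)
        go (tri> _ _ g) (tri< l _ _) _ = contradiction l (empty⁻ {f = f} e01 1≤m m≤n 1≤m m<a g)
        go _ (tri≈ _ e _) _ = contradiction e (proj₁ nv)
        go _ (tri> _ _ g) (tri< l _ _) = contradiction l (empty⁻ {f = f} e02 1≤m m≤n 1≤m m<a g)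
        go _ _ (tri≈ _ e _) = contradiction e (proj₂ nv)
        go _ _ (tri> _ _ g) = g

      low : ∀ {m} → 1 ≤ m → m ≤ z → ¬ f m < f a
      low {m} 1≤m m≤z fm<fa = go (<-cmp m a) (<-cmp m x) (<-cmp m z)
        where
        m≤n = ≤-trans m≤z z≤n
        1≤fm = proj₁ (π.range 1≤m m≤n)
        go : _ → _ → _ → _
        go (tri< m<a _ _) _ _ = empty⁻ {f = f} e00 1≤m m≤n 1≤m m<a 1≤fm fm<fa
        go (tri≈ _ refl _) _ _ = <-irrefl refl fm<fa
        go (tri> _ _ a<m) (tri< m<x _ _) _ = empty⁻ {f = f} e10 1≤m m≤n a<m m<x 1≤fm fm<fa
        go _ (tri≈ _ refl _) _ = <⇒≱ (<-trans fm<fa fa<y) y≤fx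
        go _ (tri> _ _ x<m) (tri< m<z _ _) = empty⁻ {f = f} e20 1≤m m≤n x<m m<z 1≤fm fm<fa
        go _ _ (tri≈ _ refl _) = <⇒≱ (<-trans fm<fa fa<y) y≤fz
        go _ _ (tri> _ _ z<m) = <⇒≱ z<m m≤z

      ne : ∀ {m} → x < m → m ≤ n → m ≢ z → ¬ y ≤ f m
      ne {m} x<m m≤n m≢z y≤fm = go (<-cmp m z) (<-cmp (f m) d)
        where
        1≤m = ≤-trans 1≤x (<⇒≤ x<m)
        nv = not-value 1≤m m≤n (>⇒≢ x<m) m≢z
        y<fm = ≤∧≢⇒< y≤fm (proj₁ nv ∘ sym)
        -- The top row ends at `suc n`, so `f m ≤ n` supplies the strict upper bound.
        fm<1+n = s≤s (proj₂ (π.range 1≤m m≤n))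
        go : _ → _ → _
        go (tri≈ _ m≡z _) _ = m≢z m≡z
        go _ (tri≈ _ e _) = proj₂ nv e
        go (tri< m<z _ _) (tri< l _ _) = empty⁻ {f = f} e22 1≤m m≤n x<m m<z y<fm l
        go (tri< m<z _ _) (tri> _ _ g) = empty⁻ {f = f} e23 1≤m m≤n x<m m<z g fm<1+n
        go (tri> _ _ z<m) (tri< l _ _) = empty⁻ {f = f} e32 1≤m m≤n z<m (s≤s m≤n) y<fm l
        go (tri> _ _ z<m) (tri> _ _ g) = empty⁻ {f = f} e33 1≤m m≤n z<m (s≤s m≤n) g fm<1+n

      sw : b ≡ true → ∀ {m} → 1 ≤ m → m < x → m ≢ a → y < f m
      sw b≡true {m} 1≤m m<x m≢a = go (<-cmp m a) (<-cmp (f m) y)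
        where
        m≤n = ≤-trans (<⇒≤ m<x) x≤n
        m≢z = <⇒≢ (<-trans m<x x<z)
        fa<fm = ≤∧≢⇒< (≮⇒≥ (low 1≤m (<⇒≤ (<-trans m<x x<z))))
                      (λ e → m≢a (π.injective 1≤m m≤n 1≤a a≤n (sym e)))
        go : _ → _ → y < f m
        go (tri< m<a _ _) _ = <-trans y<d (left 1≤m m<a)
        go (tri≈ _ m≡a _) _ = contradiction m≡a m≢a
        go _ (tri≈ _ e _) = contradiction e (proj₁ (not-value 1≤m m≤n (<⇒≢ m<x) m≢z))
        go (tri> _ _ a<m) (tri< l _ _) =
          contradiction l (empty⁻ {f = f} (shaded-center boxes b≡true) 1≤m m≤n a<m m<x fa<fm)
        go _ (tri> _ _ g) = g

    toBoxes : ∀ {b k} (O : Occurrence b k n f a x z) →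
              All (Shaded (Occurrence.y O) (Occurrence.d O)) (shading b)
    toBoxes {b} O = shaded b
      ( box 0 0 (λ 1≤m _ _ m<a _ l → <-asym l (<-trans fa<d (O.left 1≤m m<a)))
      ∷ box 0 1 (λ 1≤m _ _ m<a _ l → <-asym l (<-trans O.y<d (O.left 1≤m m<a)))
      ∷ box 0 2 (λ 1≤m _ _ m<a _ l → <-asym l (O.left 1≤m m<a))
      ∷ box 1 0 (λ 1≤m _ _ m<x _ l → <⇒≱ l (O.low 1≤m (<⇒≤ (<-trans m<x x<z))))
      ∷ box 2 0 (λ 1≤m _ _ m<z _ l → <⇒≱ l (O.low 1≤m (<⇒≤ m<z)))
      ∷ box 2 2 (λ _ m≤n x<m m<z g _ → <-asym g (O.ne x<m m≤n (<⇒≢ m<z)))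
      ∷ box 2 3 (λ _ m≤n x<m m<z g _ → <-asym (<-trans O.y<d g) (O.ne x<m m≤n (<⇒≢ m<z)))
      ∷ box 3 2 (λ _ m≤n z<m _ g _ → <-asym g (O.ne (<-trans x<z z<m) m≤n (>⇒≢ z<m)))
      ∷ box 3 3 (λ _ m≤n z<m _ g _ →
          <-asym (<-trans O.y<d g) (O.ne (<-trans x<z z<m) m≤n (>⇒≢ z<m)))
      ∷ [])
      (λ b≡true → box 1 1 (λ 1≤m _ a<m m<x _ l → <-asym l (O.sw b≡true 1≤m m<x (>⇒≢ a<m))))
      where
      module O = Occurrence O
      fa<d = <-trans O.fa<y O.y<d
      is = 0 ∷ a ∷ x ∷ z ∷ suc n ∷ []
      vs = 0 ∷ f a ∷ O.y ∷ O.d ∷ suc n ∷ []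
      box : ∀ i j → Empty n f (at0 is i) (at0 is (suc i)) (at0 vs j) (at0 vs (suc j)) → Shaded O.y O.d (i , j)
      box i j = empty⁺ {f = f}

  isOcc⇒occurrence : ∀ b k → T (isOcc (meshOf b k) n π (a ∷ x ∷ z ∷ [])) → Occurrence b k n f a x z
  isOcc⇒occurrence b k t
    with iso , boxes ← T-∧ {orderIso (word k) (map f (a ∷ x ∷ z ∷ []))} .to
                         (subst T (isOcc-meshOf b k n π a x z) t)
    with fa<y , y<d ← orderIso⁻ k (f a) (f x) (f z) iso
    rewrite sort-values k (values-lower-upper k (f x) (f z)) fa<y y<d =
    fromBoxes b k fa<y y<d (allᵇ⁻ _ (shading b) boxes)

  occurrence⇒isOcc : ∀ b k → Occurrence b k n f a x z → T (isOcc (meshOf b k) n π (a ∷ x ∷ z ∷ []))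
  occurrence⇒isOcc b k O = subst T (sym (isOcc-meshOf b k n π a x z))
    (T-∧ {orderIso (word k) (map f (a ∷ x ∷ z ∷ []))} .from
      ( orderIso⁺ k O.values O.fa<y O.y<d
      , subst (λ v → T (allᵇ (emptyBox n f (0 ∷ a ∷ x ∷ z ∷ suc n ∷ []) (0 ∷ v ++ [ suc n ])) (shading b)))
          (sym (sort-values k O.values O.fa<y O.y<d))
          (allᵇ⁺ _ (toBoxes O))))
    where module O = Occurrence O

-- Toggling involutions

-- κ prescribes, for each second index, which of the two patterns is counted there.
isHit : Bool → (ℕ → Kind) → ℕ → List ℕ → List ℕ → Bool
isHit b κ n π t = isOcc (meshOf b (κ (at t 2))) n π t

hits : Bool → (ℕ → Kind) → ℕ → List ℕ → List (List ℕ)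
hits b κ n π = filter (T? ∘ isHit b κ n π) (triples n)

hitCount : Bool → (ℕ → Kind) → ℕ → ℕ → ℕ
hitCount b κ n ℓ = length (filter (λ π → T? (length (hits b κ n π) ≡ᵇ ℓ)) (Sn n))

data Hit (b : Bool) (κ : ℕ → Kind) (n : ℕ) (f : ℕ → ℕ) : List ℕ → Set where
  hit : ∀ {a x z} → Occurrence b (κ x) n f a x z → Hit b κ n f (a ∷ x ∷ z ∷ [])

∈-hits⁻ : ∀ b κ {n π t} → IsPermutation n π → t ∈ hits b κ n π → Hit b κ n (at π) t
∈-hits⁻ b κ {n} {π} perm t∈ with ∈-filter⁻ (T? ∘ isHit b κ n π) {xs = triples n} t∈
... | t∈triples , t with ∈-triples⁻ n t∈triples
... | triple 1≤a a<x x<z z≤n′ = hit (isOcc⇒occurrence perm 1≤a a<x x<z z≤n′ b (κ _) t)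

∈-hits⁺ : ∀ {b κ n π t} → IsPermutation n π → Hit b κ n (at π) t → t ∈ hits b κ n π
∈-hits⁺ {b} {κ} {n} {π} perm (hit O) = ∈-filter⁺ (T? ∘ isHit b κ n π)
  (∈-triples⁺ (triple O.1≤a O.a<x O.x<z O.z≤n))
  (occurrence⇒isOcc perm O.1≤a O.a<x O.x<z O.z≤n b (κ _) O)
  where module O = Occurrence O

hits-unique : ∀ b κ n π → Unique (hits b κ n π)
hits-unique b κ n π = Unique.filter⁺ (T? ∘ isHit b κ n π) (triples-unique n)

-- The interchange at middle position `k`, given as a relation so that its symmetry can be proved
-- directly. The kind `c` is arbitrary: an occurrence of either pattern triggers the swap, and
-- `unchanged` requires that neither occurs at `k`.
data Toggle (b : Bool) (k n : ℕ) (π ρ : List ℕ) : Set where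
  swapped   : ∀ {c a z} → Occurrence b c n (at π) a k z → Swapped n (at π) (at ρ) k z →
              Toggle b k n π ρ
  unchanged : (∀ {c a z} → ¬ Occurrence b c n (at π) a k z) → π ≡ ρ → Toggle b k n π ρ

-- By `occurrence-swap` the occurrence at `k` persists with the opposite kind, so it triggers the
-- swap back.
toggle-sym : ∀ {b k n π ρ} → Toggle b k n π ρ → Toggle b k n ρ π
toggle-sym (swapped O S)     = swapped (occurrence-swap S O) (swapped-sym S)
toggle-sym (unchanged ¬O e) = unchanged (λ {c} {a} {z} → subst (λ π → ¬ Occurrence _ c _ (at π) a _ z) e ¬O) (sym e)

-- The third position is determined by `k`, so both toggles exchange the same two values. Applied to
-- reversed toggles, this gives injectivity.
toggle-functional : ∀ {b k n π ρ ρ′} → IsPermutation n ρ → IsPermutation n ρ′ →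
                    Toggle b k n π ρ → Toggle b k n π ρ′ → ρ ≡ ρ′
toggle-functional _ _ (unchanged _ refl) (unchanged _ refl) = refl
toggle-functional _ _ (unchanged ¬O _) (swapped O _) = contradiction O ¬O
toggle-functional _ _ (swapped O _) (unchanged ¬O _) = contradiction O ¬O
toggle-functional {n = n} {π} {ρ} {ρ′} R R′ (swapped O S) (swapped O′ S′)
  with refl ← occurrence-unique-third O O′ = permutation-ext R R′
    (λ 1≤m m≤n → S.elim (λ m v → 1 ≤ m → m ≤ n → v ≡ at ρ′ m)
      (λ _ _ → sym S′.at-x)
      (λ _ _ → sym S′.at-z)
      (λ m≢x m≢z 1≤m m≤n → sym (S′.off 1≤m m≤n m≢x m≢z))
      1≤m m≤n 1≤m m≤n)
  where
  module S = Swapped S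
  module S′ = Swapped S′


-- Construction of the toggled permutation

swapValues : (ℕ → ℕ) → (x z m : ℕ) → ℕ
swapValues f x z m = if does (m ≟ x) then f z else if does (m ≟ z) then f x else f m

swapValues-at-x : ∀ f x z → swapValues f x z x ≡ f z
swapValues-at-x f x z rewrite dec-true (x ≟ x) refl = refl

swapValues-at-z : ∀ f {x z} → z ≢ x → swapValues f x z z ≡ f x
swapValues-at-z f {x} {z} z≢x rewrite dec-false (z ≟ x) z≢x | dec-true (z ≟ z) refl = refl

swapValues-off : ∀ f {x z m} → m ≢ x → m ≢ z → swapValues f x z m ≡ f m
swapValues-off f {x} {z} {m} m≢x m≢z rewrite dec-false (m ≟ x) m≢x | dec-false (m ≟ z) m≢z = refl

swapList : ℕ → List ℕ → (x z : ℕ) → List ℕ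
swapList n π x z = map (swapValues (at π) x z) (oneTo n)

swapList-swapped : ∀ {n} π {x z} → 1 ≤ x → x < z → z ≤ n →
                   Swapped n (at π) (at (swapList n π x z)) x z
swapList-swapped {n} π {x} {z} 1≤x x<z z≤n′ = record
  { at-x = trans (at-map-oneTo g 1≤x (≤-trans (<⇒≤ x<z) z≤n′)) (swapValues-at-x (at π) x z)
  ; at-z = trans (at-map-oneTo g (≤-trans 1≤x (<⇒≤ x<z)) z≤n′) (swapValues-at-z (at π) (>⇒≢ x<z))
  ; off  = λ 1≤m m≤n m≢x m≢z → trans (at-map-oneTo g 1≤m m≤n) (swapValues-off (at π) m≢x m≢z)
  }
  where g = swapValues (at π) x z

swapped-permutation : ∀ {n π ρ x z} → IsPermutation n π → length ρ ≡ n → 1 ≤ x → x < z → z ≤ n →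
                      Swapped n (at π) (at ρ) x z → IsPermutation n ρ
swapped-permutation {n} {π} {ρ} {x} {z} perm size 1≤x x<z z≤n′ S = record
  { size      = size
  ; range     = λ 1≤m m≤n → S.elim (λ m v → 1 ≤ m → m ≤ n → 1 ≤ v × v ≤ n)
      (λ _ _ → π.range 1≤z z≤n′)
      (λ _ _ → π.range 1≤x x≤n)
      (λ _ _ → π.range)
      1≤m m≤n 1≤m m≤n
  ; injective = λ 1≤i i≤n 1≤j j≤n → S.elim
      (λ i v → 1 ≤ i → i ≤ n → ∀ {j} → 1 ≤ j → j ≤ n → v ≡ at ρ j → i ≡ j)
      (λ _ _ → against z
        (λ _ → refl)
        (λ e → sym (π.injective 1≤z z≤n′ 1≤x x≤n e))
        (λ 1≤j j≤n m≢x m≢z e → contradiction (sym (π.injective 1≤z z≤n′ 1≤j j≤n e)) m≢z))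
      (λ _ _ → against x
        (λ e → sym (π.injective 1≤x x≤n 1≤z z≤n′ e))
        (λ _ → refl)
        (λ 1≤j j≤n m≢x m≢z e → contradiction (sym (π.injective 1≤x x≤n 1≤j j≤n e)) m≢x))
      (λ {i} i≢x i≢z 1≤i i≤n → against i
        (λ e → contradiction (π.injective 1≤i i≤n 1≤z z≤n′ e) i≢z)
        (λ e → contradiction (π.injective 1≤i i≤n 1≤x x≤n e) i≢x)
        (λ 1≤j j≤n _ _ → π.injective 1≤i i≤n 1≤j j≤n))
      1≤i i≤n 1≤i i≤n 1≤j j≤n
  }
  where
  module S = Swapped S
  module π = IsPermutation perm
  x≤n = ≤-trans (<⇒≤ x<z) z≤n′
  1≤z = ≤-trans 1≤x (<⇒≤ x<z)

  -- `p` is the position in `π` of the value that `ρ` has at `i`: `z` for `x`, `x` for `z`, and `i`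
  -- itself elsewhere. A second case analysis, on `j`, then reduces injectivity of `ρ` to that of
  -- `π`.
  against : ∀ {i} p → (at π p ≡ at π z → i ≡ x) → (at π p ≡ at π x → i ≡ z) →
            (∀ {j} → 1 ≤ j → j ≤ n → j ≢ x → j ≢ z → at π p ≡ at π j → i ≡ j) →
            ∀ {j} → 1 ≤ j → j ≤ n → at π p ≡ at ρ j → i ≡ j
  against {i} p at-x at-z off 1≤j j≤n = S.elim (λ j w → 1 ≤ j → j ≤ n → at π p ≡ w → i ≡ j)
    (λ _ _ → at-x)
    (λ _ _ → at-z)
    (λ m≢x m≢z 1≤j j≤n → off 1≤j j≤n m≢x m≢z)
    1≤j j≤n 1≤j j≤n

occurrence-at? : ∀ b k {n π} → IsPermutation n π →
                 Dec (∃[ c ] ∃[ a ] ∃[ z ] Occurrence b c n (at π) a k z)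
occurrence-at? b k {n} {π} perm
  with any? (λ t → (at t 2 ≟ k) ×-dec (T? (isOcc (meshOf b asc) n π t) ⊎-dec
                                       T? (isOcc (meshOf b desc) n π t))) (triples n)
... | yes p with t , t∈ , q ← find p with ∈-triples⁻ n t∈ | q
...   | triple 1≤a a<x x<z z≤n′ | refl , inj₁ o =
        yes (asc , _ , _ , isOcc⇒occurrence perm 1≤a a<x x<z z≤n′ b asc o)
...   | triple 1≤a a<x x<z z≤n′ | refl , inj₂ o =
        yes (desc , _ , _ , isOcc⇒occurrence perm 1≤a a<x x<z z≤n′ b desc o)
occurrence-at? b k {n} {π} perm | no ¬p = no λ (c , a , z , O) →
  let open Occurrence O in
  ¬p (lose (∈-triples⁺ (triple 1≤a a<x x<z z≤n)) (refl , either c O))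
  where
  either : ∀ c {a z} → Occurrence b c n (at π) a k z →
           T (isOcc (meshOf b asc) n π (a ∷ k ∷ z ∷ [])) ⊎ T (isOcc (meshOf b desc) n π (a ∷ k ∷ z ∷ []))
  either asc  O = let open Occurrence O in
    inj₁ (occurrence⇒isOcc perm 1≤a a<x x<z z≤n b asc O)
  either desc O = let open Occurrence O in
    inj₂ (occurrence⇒isOcc perm 1≤a a<x x<z z≤n b desc O)

toggle-exists : ∀ b k {n π} → IsPermutation n π → ∃[ ρ ] IsPermutation n ρ × Toggle b k n π ρ
toggle-exists b k {n} {π} perm with occurrence-at? b k perm
... | no ¬O = π , perm , unchanged (λ O → ¬O (_ , _ , _ , O)) refl
... | yes (_ , _ , z , O) = swapList n π k z ,
  swapped-permutation perm (trans (length-map _ (oneTo n)) (length-oneTo n)) O.1≤x O.x<z O.z≤n S ,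
  swapped O S
  where
  module O = Occurrence O
  S = swapList-swapped π O.1≤x O.x<z O.z≤n

-- Hit counts under a toggle

record DifferAt (k : ℕ) (κ κ′ : ℕ → Kind) : Set where
  field
    at-k : κ′ k ≡ flip (κ k)
    off  : ∀ {x} → x ≢ k → κ′ x ≡ κ x

differAt-sym : ∀ {k κ κ′} → DifferAt k κ κ′ → DifferAt k κ′ κ
differAt-sym D = record
  { at-k = trans (sym (flip-involutive _)) (cong flip (sym D.at-k))
  ; off  = λ x≢k → sym (D.off x≢k)
  } where module D = DifferAt D

-- Both hits have the kind that `κ` prescribes at their common middle position, and that position
-- fixes the other two.
hit-injective : ∀ {b κ n f t t′} → Hit b κ n f t → Hit b κ n f t′ → at t 2 ≡ at t′ 2 → t ≡ t′
hit-injective (hit O) (hit O′) refl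
  with refl ← occurrence-unique-first O O′ | refl ← occurrence-unique-third O O′ = refl

-- A hit at `k` changes kind, as does the prescription; a hit elsewhere keeps its kind, as does the
-- prescription. The third position may move, so hits are matched by their second index.
toggle-hit : ∀ {b k n π ρ κ κ′ t} → DifferAt k κ κ′ → Toggle b k n π ρ →
             Hit b κ n (at π) t → ∃[ t′ ] Hit b κ′ n (at ρ) t′ × at t 2 ≡ at t′ 2
toggle-hit {b} {k} {n} {ρ = ρ} D t (hit {a} {x} {z} O) with x ≟ k | t
... | yes refl | unchanged ¬O _ = contradiction O ¬O
... | no x≢k | unchanged _ refl = _ ,
  hit (subst (λ c → Occurrence b c n (at ρ) a x z) (sym (DifferAt.off D x≢k)) O) , refl
-- The swap may come from another occurrence `P` at `k`; uniqueness of the third position shows that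
-- it exchanges exactly the last two entries of `O`.
... | yes refl | swapped P S with refl ← occurrence-unique-third P O = _ ,
  hit (subst (λ c → Occurrence b c n (at ρ) a k z) (sym (DifferAt.at-k D)) (occurrence-swap S O)) , refl
toggle-hit {b} {n = n} {ρ = ρ} D t (hit {a} {x} O) | no x≢k | swapped P S
  with z″ , O″ ← occurrence-swap-elsewhere S P O x≢k = _ ,
  hit (subst (λ c → Occurrence b c n (at ρ) a x z″) (sym (DifferAt.off D x≢k)) O″) , refl

length-hits-≤ : ∀ {b k n π ρ κ κ′} → IsPermutation n π → IsPermutation n ρ → DifferAt k κ κ′ →
                Toggle b k n π ρ → length (hits b κ n π) ≤ length (hits b κ′ n ρ)
length-hits-≤ {b} {n = n} {π} {κ = κ} {κ′} P R D tog =
  length-≤ (λ t t′ → at t 2 ≡ at t′ 2) (hits-unique b κ n π)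
    (λ t∈ → let t′ , h , e = toggle-hit D tog (∈-hits⁻ b κ P t∈) in t′ , ∈-hits⁺ R h , e)
    (λ t∈ t′∈ e e′ → hit-injective (∈-hits⁻ b κ P t∈) (∈-hits⁻ b κ P t′∈) (trans e (sym e′)))

length-hits-toggle : ∀ {b k n π ρ κ κ′} → IsPermutation n π → IsPermutation n ρ → DifferAt k κ κ′ →
                     Toggle b k n π ρ → length (hits b κ n π) ≡ length (hits b κ′ n ρ)
length-hits-toggle P R D t =
  ≤-antisym (length-hits-≤ P R D t) (length-hits-≤ R P (differAt-sym D) (toggle-sym t))

-- Every permutation has a toggle, the number of hits is preserved, and toggles are injective. One
-- inequality suffices, since `DifferAt` is symmetric.
hitCount-≤ : ∀ b {k κ κ′} n ℓ → DifferAt k κ κ′ → hitCount b κ n ℓ ≤ hitCount b κ′ n ℓ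
hitCount-≤ b {k} {κ} {κ′} n ℓ D =
  length-≤ (Toggle b k n) (Unique.filter⁺ (has κ) (Sn-unique n)) image
    (λ p q s t → toggle-functional (perm p) (perm q) (toggle-sym s) (toggle-sym t))
  where
  has : ∀ κ π → Dec (T (length (hits b κ n π) ≡ᵇ ℓ))
  has κ π = T? (length (hits b κ n π) ≡ᵇ ℓ)

  perm : ∀ {π} → π ∈ filter (has κ) (Sn n) → IsPermutation n π
  perm π∈ = ∈-Sn⁻ (proj₁ (∈-filter⁻ (has κ) {xs = Sn n} π∈))

  image : ∀ {π} → π ∈ filter (has κ) (Sn n) → ∃[ ρ ] ρ ∈ filter (has κ′) (Sn n) × Toggle b k n π ρ
  image π∈ with ρ , R , t ← toggle-exists b k (perm π∈) =
    ρ , ∈-filter⁺ (has κ′) (∈-Sn⁺ R)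
      (subst (λ h → T (h ≡ᵇ ℓ)) (length-hits-toggle (perm π∈) R D t)
        (proj₂ (∈-filter⁻ (has κ) {xs = Sn n} π∈))) , t

hitCount-≡ : ∀ b {k κ κ′} n ℓ → DifferAt k κ κ′ → hitCount b κ n ℓ ≡ hitCount b κ′ n ℓ
hitCount-≡ b n ℓ D = ≤-antisym (hitCount-≤ b n ℓ D) (hitCount-≤ b n ℓ (differAt-sym D))

-- Interpolation between the two patterns

ascBelow : ℕ → ℕ → Kind
ascBelow j x = if does (x <? j) then asc else desc

ascBelow-< : ∀ {j x} → x < j → ascBelow j x ≡ asc
ascBelow-< {j} {x} x<j rewrite dec-true (x <? j) x<j = refl

ascBelow-≥ : ∀ {j x} → j ≤ x → ascBelow j x ≡ desc
ascBelow-≥ {j} {x} j≤x rewrite dec-false (x <? j) (≤⇒≯ j≤x) = refl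

ascBelow-differAt : ∀ j → DifferAt j (ascBelow j) (ascBelow (suc j))
ascBelow-differAt j = record
  { at-k = trans (ascBelow-< {suc j} ≤-refl) (cong flip (sym (ascBelow-≥ {j} ≤-refl)))
  ; off  = off
  }
  where
  off : ∀ {x} → x ≢ j → ascBelow (suc j) x ≡ ascBelow j x
  off {x} x≢j with <-cmp x j
  ... | tri< x<j _ _ = trans (ascBelow-< (m<n⇒m<1+n x<j)) (sym (ascBelow-< x<j))
  ... | tri≈ _ x≡j _ = contradiction x≡j x≢j
  ... | tri> _ _ j<x = trans (ascBelow-≥ j<x) (sym (ascBelow-≥ (<⇒≤ j<x)))

hitCount-ascBelow : ∀ b n ℓ j → hitCount b (ascBelow j) n ℓ ≡ hitCount b (ascBelow 0) n ℓ
hitCount-ascBelow b n ℓ zero    = refl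
hitCount-ascBelow b n ℓ (suc j) =
  trans (sym (hitCount-≡ b n ℓ (ascBelow-differAt j))) (hitCount-ascBelow b n ℓ j)

-- Middle positions never exceed `n`, so `κ` need be constant only up to `n`. This covers
-- `ascBelow (suc n)`, which becomes `desc` beyond that range.
hitCount-constant : ∀ b c {κ} n ℓ → (∀ {x} → x ≤ n → κ x ≡ c) →
                    hitCount b κ n ℓ ≡ count (meshOf b c) n ℓ
hitCount-constant b c {κ} n ℓ κ≡c = length-filter-cong _ _ (Sn n) λ {π} _ → cong (_≡ᵇ ℓ)
  (length-filter-cong _ _ (triples n) (λ t∈ → cong (λ k → isOcc (meshOf b k) n π _) (κ-second t∈)))
  where
  κ-second : ∀ {t} → t ∈ triples n → κ (at t 2) ≡ c
  κ-second t∈ with ∈-triples⁻ n t∈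
  ... | triple _ _ x<z z≤n′ = κ≡c (≤-trans (<⇒≤ x<z) z≤n′)

equidistributed : ∀ b → meshOf b asc ∼d meshOf b desc
equidistributed b n ℓ = begin
  count (meshOf b asc) n ℓ             ≡⟨ hitCount-constant b asc n ℓ (ascBelow-< ∘ s≤s) ⟨
  hitCount b (ascBelow (suc n)) n ℓ    ≡⟨ hitCount-ascBelow b n ℓ (suc n) ⟩
  hitCount b (ascBelow 0) n ℓ          ≡⟨ hitCount-constant b desc n ℓ (λ _ → refl) ⟩
  count (meshOf b desc) n ℓ            ∎
  where open ≡-Reasoning

theorem4p10 : (mesh 3 p123 R₁ ∼d mesh 3 p132 R₁) × (mesh 3 p123 R₂ ∼d mesh 3 p132 R₂)
theorem4p10 = equidistributed false , equidistributed true
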